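{- Let $l\ge 2$ be a fixed integer and let $e=e_n$ satisfy $e/n\to\infty$ and $e\le n^2/4$. Then $$ex(n,e,P_l,K_3)=(1+o(1))\,N(P_l,B^e_n)\qquad(n\to\infty).$$
   Context: $P_l$ is the path on $l$ vertices and $K_3$ the triangle. For graphs $H,G$, $N(H,G)$ is the number of subgraphs of $G$ isomorphic to $H$. $ex(n,e,H,F)$ denotes the maximum of $N(H,G)$ over all $F$-free graphs $G$ with $n$ vertices and $e$ edges. For positive integers $n,e$ with $e\le n^2/4$, let $t$ be the smallest positive integer $i$ with $i(n-i)\ge e$; $B^e_n$ is obtained from the complete bipartite graph $K_{t,n-t}$ by picking a vertex of degree $n-t$ and deleting $t(n-t)-e$ of its edges. -}

module Defs where

open import Data.Bool using (Bool; true; false; _∧_; _∨_; not; if_then_else_)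
open import Data.Nat using (ℕ; zero; suc; _+_; _*_; _∸_; _≤_; _<_; _≤ᵇ_; _<ᵇ_)
open import Data.Fin using (Fin; toℕ)
open import Data.List using (List; []; _∷_; map; concatMap; filter; length; allFin; cartesianProduct)
open import Data.Vec using (Vec; []; _∷_)
open import Data.Product using (_×_; _,_)
open import Data.Empty using (⊥)
open import Relation.Binary.PropositionalEquality using (_≡_; refl; cong; cong₂)
open import Data.Bool.Properties using (∨-comm)
open import Relation.Nullary.Decidable using (yes; no)
open import Data.Bool.Properties using (T?)
open import Data.Bool using (T)

record Graph (n : ℕ) : Set where
  field
    adj   : Fin n → Fin n → Bool
    sym   : ∀ i j → adj i j ≡ adj j i
    irrefl : ∀ i → adj i i ≡ false
open Graph public

_==_ : {n : ℕ} → Fin n → Fin n → Bool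
i == j = (toℕ i ≤ᵇ toℕ j) ∧ (toℕ j ≤ᵇ toℕ i)

countB : {A : Set} → (A → Bool) → List A → ℕ
countB p xs = length (filter (λ x → T? (p x)) xs)

numEdges : {n : ℕ} → Graph n → ℕ
numEdges {n} G =
  countB (λ { (i , j) → (toℕ i <ᵇ toℕ j) ∧ adj G i j })
         (cartesianProduct (allFin n) (allFin n))

-- G contains no triangle K₃ (irreflexivity makes i, j, k automatically distinct)
TriangleFree : {n : ℕ} → Graph n → Set
TriangleFree {n} G =
  (i j k : Fin n) → adj G i j ≡ true → adj G j k ≡ true → adj G i k ≡ true → ⊥

-- Copies of the path P_l.
-- A subgraph of G isomorphic to P_l (l ≥ 2) is determined by its vertex
-- sequence (v₁,…,v_l): distinct vertices with v_i ~ v_{i+1}; the sequence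
-- and its reversal give the same subgraph, so we fix the orientation by
-- requiring toℕ v₁ < toℕ v_l.  N(P_l, G) counts these.

allVecs : (n l : ℕ) → List (Vec (Fin n) l)
allVecs n zero    = [] ∷ []
allVecs n (suc l) = concatMap (λ v → map (λ x → x ∷ v) (allFin n)) (allVecs n l)

notIn : {n l : ℕ} → Fin n → Vec (Fin n) l → Bool
notIn x []       = true
notIn x (y ∷ ys) = not (x == y) ∧ notIn x ys

distinct : {n l : ℕ} → Vec (Fin n) l → Bool
distinct []       = true
distinct (x ∷ xs) = notIn x xs ∧ distinct xs

consecAdj : {n l : ℕ} → Graph n → Vec (Fin n) l → Bool
consecAdj G []           = true
consecAdj G (x ∷ [])     = true
consecAdj G (x ∷ y ∷ ys) = adj G x y ∧ consecAdj G (y ∷ ys)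

lastV : {n l : ℕ} → Fin n → Vec (Fin n) l → Fin n
lastV x []       = x
lastV x (y ∷ ys) = lastV y ys

oriented : {n l : ℕ} → Vec (Fin n) l → Bool
oriented []       = false
oriented (x ∷ xs) = toℕ x <ᵇ toℕ (lastV x xs)

isPathCopy : {n l : ℕ} → Graph n → Vec (Fin n) l → Bool
isPathCopy G v = distinct v ∧ consecAdj G v ∧ oriented v

NP : (l : ℕ) → {n : ℕ} → Graph n → ℕ
NP l {n} G = countB (isPathCopy G) (allVecs n l)

search : (n e k fuel : ℕ) → ℕ
search n e k zero       = n
search n e k (suc fuel) = if e ≤ᵇ k * (n ∸ k) then k else search n e (suc k) fuel

tPar : (n e : ℕ) → ℕ
tPar n e = search n e 1 n

-- Vertices 0,…,t-1 form the part of size t (these have degree n - t in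
-- K_{t,n-t}); vertices t,…,n-1 form the other part.  From vertex 0 we
-- delete the d = t(n-t) - e edges to vertices t,…,t+d-1.
BAdj : (n e : ℕ) → Fin n → Fin n → Bool
BAdj n e i j =
  let t  = tPar n e
      d  = t * (n ∸ t) ∸ e
      ai = toℕ i <ᵇ t
      aj = toℕ j <ᵇ t
      cross   = (ai ∧ not aj) ∨ (aj ∧ not ai)
      deleted = ((toℕ i ≤ᵇ 0) ∧ (toℕ j <ᵇ t + d)) ∨ ((toℕ j ≤ᵇ 0) ∧ (toℕ i <ᵇ t + d))
  in cross ∧ not deleted

private
  crossSym : (a b : Bool) → ((a ∧ not b) ∨ (b ∧ not a)) ≡ ((b ∧ not a) ∨ (a ∧ not b))
  crossSym true  true  = refl
  crossSym true  false = refl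
  crossSym false true  = refl
  crossSym false false = refl

  crossIrr : (a : Bool) → ((a ∧ not a) ∨ (a ∧ not a)) ≡ false
  crossIrr true  = refl
  crossIrr false = refl

BAdj-sym : (n e : ℕ) → ∀ i j → BAdj n e i j ≡ BAdj n e j i
BAdj-sym n e i j =
  cong₂ (λ x y → x ∧ not y)
        (crossSym (toℕ i <ᵇ tPar n e) (toℕ j <ᵇ tPar n e))
        (∨-comm ((toℕ i ≤ᵇ 0) ∧ (toℕ j <ᵇ tPar n e + (tPar n e * (n ∸ tPar n e) ∸ e)))
                ((toℕ j ≤ᵇ 0) ∧ (toℕ i <ᵇ tPar n e + (tPar n e * (n ∸ tPar n e) ∸ e))))

BAdj-irrefl : (n e : ℕ) → ∀ i → BAdj n e i i ≡ false
BAdj-irrefl n e i = cong (λ x → x ∧ not (((toℕ i ≤ᵇ 0) ∧ (toℕ i <ᵇ tPar n e + (tPar n e * (n ∸ tPar n e) ∸ e))) ∨ ((toℕ i ≤ᵇ 0) ∧ (toℕ i <ᵇ tPar n e + (tPar n e * (n ∸ tPar n e) ∸ e))))) (crossIrr (toℕ i <ᵇ tPar n e))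

B : (n e : ℕ) → Graph n
B n e = record { adj = BAdj n e ; sym = BAdj-sym n e ; irrefl = BAdj-irrefl n e }

{-# OPTIONS --safe #-}
module Submission where

-- Reversal shows that twice the number of copies of P_l is the number of
-- injective walks on l vertices.  In a triangle-free graph with e edges, a vertex
-- is adjacent to at most one end of any edge, so adding two vertices to a walk
-- multiplies the number of walks by at most e.  Hence there are at most 2 e^k
-- walks on 2k vertices and n e^k walks on 2k+1 vertices.  Conversely B contains
-- the complete bipartite graph on parts of sizes t-1 and n-t, where
-- t (n-t) >= e and n-t >= t >= e/n.  Counting its injective walks part by part
-- gives the same bounds up to factors 1 - O(l/t), which tend to 1.

open import Defs renaming (sym to adj-sym)
open import Data.Bool using (Bool; true; false; _∧_; _∨_; not; T)
open import Data.Bool.Properties using (T-≡; ∧-assoc; ∧-comm)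
open import Data.Empty using (⊥; ⊥-elim)
open import Data.Fin using (Fin; toℕ; zero; suc)
open import Data.List using (List; []; _∷_; _++_; map; concatMap; allFin; cartesianProduct)
open import Data.List.Properties using (map-tabulate)
open import Data.Nat
open import Data.Nat.ListAction using (sum)
open import Data.Nat.Properties
open import Data.Nat.Tactic.RingSolver using (solve-∀)
open import Data.Product using (Σ; _×_; _,_; proj₁; proj₂; ∃-syntax)
open import Data.Sum using (_⊎_; inj₁; inj₂)
open import Data.Vec using (Vec; []; _∷_; _∷ʳ_; head; tail; reverse)
open import Data.Vec.Properties using (reverse-∷)
open import Function.Base using (_∘_)
open import Function.Bundles using (Equivalence)
open import Relation.Nullary using (yes; no)
open import Relation.Binary.PropositionalEquality
  using (_≡_; refl; sym; trans; cong; cong₂; subst; module ≡-Reasoning)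

private
  variable
    X Y : Set
    n l : ℕ

-- Finite sums and indicators

∑ : List X → (X → ℕ) → ℕ
∑ xs f = sum (map f xs)

∑-cong : (xs : List X) {f g : X → ℕ} → (∀ x → f x ≡ g x) → ∑ xs f ≡ ∑ xs g
∑-cong []       f≗g = refl
∑-cong (x ∷ xs) f≗g = cong₂ _+_ (f≗g x) (∑-cong xs f≗g)

∑-mono : (xs : List X) {f g : X → ℕ} → (∀ x → f x ≤ g x) → ∑ xs f ≤ ∑ xs g
∑-mono []       f≤g = z≤n
∑-mono (x ∷ xs) f≤g = +-mono-≤ (f≤g x) (∑-mono xs f≤g)

∑-zero : (xs : List X) → ∑ xs (λ _ → 0) ≡ 0
∑-zero []       = refl
∑-zero (x ∷ xs) = ∑-zero xs

∑-+ : (xs : List X) (f g : X → ℕ) → ∑ xs (λ x → f x + g x) ≡ ∑ xs f + ∑ xs g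
∑-+ []       f g = refl
∑-+ (x ∷ xs) f g rewrite ∑-+ xs f g = interchange (f x) (g x) (∑ xs f) (∑ xs g)
  where
  interchange : ∀ a b c d → (a + b) + (c + d) ≡ (a + c) + (b + d)
  interchange = solve-∀

∑-*ˡ : (c : ℕ) (xs : List X) (f : X → ℕ) → ∑ xs (λ x → c * f x) ≡ c * ∑ xs f
∑-*ˡ c []       f = sym (*-zeroʳ c)
∑-*ˡ c (x ∷ xs) f rewrite ∑-*ˡ c xs f = sym (*-distribˡ-+ c (f x) (∑ xs f))

∑-*ʳ : (c : ℕ) (xs : List X) (f : X → ℕ) → ∑ xs (λ x → f x * c) ≡ ∑ xs f * c
∑-*ʳ c []       f = refl
∑-*ʳ c (x ∷ xs) f rewrite ∑-*ʳ c xs f = sym (*-distribʳ-+ c (f x) (∑ xs f))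

∑-++ : (xs ys : List X) (f : X → ℕ) → ∑ (xs ++ ys) f ≡ ∑ xs f + ∑ ys f
∑-++ []       ys f = refl
∑-++ (x ∷ xs) ys f rewrite ∑-++ xs ys f = sym (+-assoc (f x) (∑ xs f) (∑ ys f))

∑-map : (g : Y → X) (ys : List Y) (f : X → ℕ) → ∑ (map g ys) f ≡ ∑ ys (f ∘ g)
∑-map g []       f = refl
∑-map g (y ∷ ys) f = cong (f (g y) +_) (∑-map g ys f)

∑-concatMap : (h : Y → List X) (ys : List Y) (f : X → ℕ) →
  ∑ (concatMap h ys) f ≡ ∑ ys (λ y → ∑ (h y) f)
∑-concatMap h []       f = refl
∑-concatMap h (y ∷ ys) f =
  trans (∑-++ (h y) (concatMap h ys) f) (cong (∑ (h y) f +_) (∑-concatMap h ys f))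

∑-swap : (xs : List X) (ys : List Y) (f : X → Y → ℕ) →
  ∑ xs (λ x → ∑ ys (f x)) ≡ ∑ ys (λ y → ∑ xs (λ x → f x y))
∑-swap []       ys f = sym (∑-zero ys)
∑-swap (x ∷ xs) ys f = trans (cong (∑ ys (f x) +_) (∑-swap xs ys f))
  (sym (∑-+ ys (f x) (λ y → ∑ xs (λ z → f z y))))

∑-cartesianProduct : (xs : List X) (ys : List Y) (f : X × Y → ℕ) →
  ∑ (cartesianProduct xs ys) f ≡ ∑ xs (λ x → ∑ ys (λ y → f (x , y)))
∑-cartesianProduct []       ys f = refl
∑-cartesianProduct (x ∷ xs) ys f =
  trans (∑-++ (map (x ,_) ys) (cartesianProduct xs ys) f)
    (cong₂ _+_ (∑-map (x ,_) ys f) (∑-cartesianProduct xs ys f))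

ind : Bool → ℕ
ind true  = 1
ind false = 0

ind≤1 : ∀ b → ind b ≤ 1
ind≤1 true  = ≤-refl
ind≤1 false = z≤n

ind-∧ : ∀ a b → ind (a ∧ b) ≡ ind a * ind b
ind-∧ true  b = sym (+-identityʳ (ind b))
ind-∧ false b = refl

countB≡∑ : (p : X → Bool) (xs : List X) → countB p xs ≡ ∑ xs (ind ∘ p)
countB≡∑ p []       = refl
countB≡∑ p (x ∷ xs) with p x
... | true  = cong suc (countB≡∑ p xs)
... | false = countB≡∑ p xs

∑ᶠ : (Fin n → ℕ) → ℕ
∑ᶠ {n} = ∑ (allFin n)

∑ᶠ-suc : (f : Fin (suc n) → ℕ) → ∑ᶠ f ≡ f zero + ∑ᶠ (f ∘ suc)
∑ᶠ-suc {n} f = cong (λ ys → f zero + sum ys)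
  (trans (map-tabulate suc f) (sym (map-tabulate (λ x → x) (f ∘ suc))))

∑ᶠ-one : ∑ᶠ {n} (λ _ → 1) ≡ n
∑ᶠ-one {zero}  = refl
∑ᶠ-one {suc n} = trans (∑ᶠ-suc {n} (λ _ → 1)) (cong suc ∑ᶠ-one)

-- Boolean comparisons and interval counts

T⇒≡true : ∀ {b} → T b → b ≡ true
T⇒≡true = Equivalence.to T-≡

≡true⇒T : ∀ {b} → b ≡ true → T b
≡true⇒T = Equivalence.from T-≡

-- Not definitional: `suc m ≤ᵇ suc k` reduces to `m <ᵇ suc k`, which meets `m ≤ᵇ k` only after a
-- split on `m`. Every induction on `_==_` goes through it.
≤ᵇ-suc : ∀ m k → (suc m ≤ᵇ suc k) ≡ (m ≤ᵇ k)
≤ᵇ-suc zero    k = refl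
≤ᵇ-suc (suc m) k = refl

<ᵇ-true : ∀ {m k} → m < k → (m <ᵇ k) ≡ true
<ᵇ-true m<k = T⇒≡true (<⇒<ᵇ m<k)

≤ᵇ-true : ∀ {m k} → m ≤ k → (m ≤ᵇ k) ≡ true
≤ᵇ-true m≤k = T⇒≡true (≤⇒≤ᵇ m≤k)

≤ᵇ-not-<ᵇ : ∀ m k → (m ≤ᵇ k) ≡ not (k <ᵇ m)
≤ᵇ-not-<ᵇ zero    zero    = refl
≤ᵇ-not-<ᵇ zero    (suc k) = refl
≤ᵇ-not-<ᵇ (suc m) zero    = refl
≤ᵇ-not-<ᵇ (suc m) (suc k) = trans (≤ᵇ-suc m k) (≤ᵇ-not-<ᵇ m k)

<ᵇ-false : ∀ {m k} → k ≤ m → (m <ᵇ k) ≡ false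
<ᵇ-false {m} {k} k≤m with m <ᵇ k in eq
... | true  = ⊥-elim (≤⇒≯ k≤m (<ᵇ⇒< m k (≡true⇒T eq)))
... | false = refl

≤ᵇ-false : ∀ {m k} → k < m → (m ≤ᵇ k) ≡ false
≤ᵇ-false {m} {k} k<m rewrite ≤ᵇ-not-<ᵇ m k | <ᵇ-true k<m = refl

∑ᶠ-≤ : ∀ n m → ∑ᶠ {n} (λ x → ind (m ≤ᵇ toℕ x)) ≡ n ∸ m
∑ᶠ-≤ n       zero    = ∑ᶠ-one {n}
∑ᶠ-≤ zero    (suc m) = refl
∑ᶠ-≤ (suc n) (suc m) = trans (∑ᶠ-suc {n} (λ x → ind (suc m ≤ᵇ toℕ x)))
  (trans (∑-cong (allFin n) (λ x → cong ind (≤ᵇ-suc m (toℕ x)))) (∑ᶠ-≤ n m))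

inInterval : ℕ → ℕ → ℕ → Bool
inInterval a b x = (a ≤ᵇ x) ∧ (x <ᵇ b)

-- Adjoining the ray from `b` completes the interval to the ray from `a`, and rays are counted by
-- `∑ᶠ-≤`. Working with the sum and cancelling keeps truncated subtraction under control.
∑ᶠ-interval : ∀ n {a b} → a ≤ b → b ≤ n → ∑ᶠ {n} (λ x → ind (inInterval a b (toℕ x))) ≡ b ∸ a
∑ᶠ-interval n {a} {b} a≤b b≤n = +-cancelʳ-≡ (n ∸ b) _ _ (begin
  ∑ᶠ {n} inside + (n ∸ b)              ≡⟨ cong (∑ᶠ {n} inside +_) (sym (∑ᶠ-≤ n b)) ⟩
  ∑ᶠ {n} inside + ∑ᶠ {n} above         ≡⟨ sym (∑-+ (allFin n) inside above) ⟩
  ∑ᶠ {n} (λ x → inside x + above x)    ≡⟨ ∑-cong (allFin n) (λ x → split (toℕ x)) ⟩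
  ∑ᶠ {n} (λ x → ind (a ≤ᵇ toℕ x))      ≡⟨ ∑ᶠ-≤ n a ⟩
  n ∸ a                                ≡⟨ cong (_∸ a) (sym (m+[n∸m]≡n b≤n)) ⟩
  (b + (n ∸ b)) ∸ a                    ≡⟨ +-∸-comm (n ∸ b) a≤b ⟩
  (b ∸ a) + (n ∸ b)                    ∎)
  where
  open ≡-Reasoning
  inside above : Fin n → ℕ
  inside x = ind (inInterval a b (toℕ x))
  above x = ind (b ≤ᵇ toℕ x)
  split : ∀ x → ind (inInterval a b x) + ind (b ≤ᵇ x) ≡ ind (a ≤ᵇ x)
  split x with b ≤? x
  ... | yes b≤x rewrite ≤ᵇ-true b≤x | ≤ᵇ-true (≤-trans a≤b b≤x) | <ᵇ-false b≤x = refl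
  ... | no  b≰x rewrite ≤ᵇ-false (≰⇒> b≰x) | <ᵇ-true (≰⇒> b≰x) with a ≤ᵇ x
  ...   | true  = refl
  ...   | false = refl

∑ᶠ-== : (y : Fin n) → ∑ᶠ (λ x → ind (x == y)) ≤ 1
∑ᶠ-== {suc n} zero = ≤-reflexive (trans (∑ᶠ-suc (λ x → ind (x == zero {n}))) (cong suc (∑-zero (allFin n))))
∑ᶠ-== {suc n} (suc y) = ≤-trans (≤-reflexive (∑ᶠ-suc (λ x → ind (x == suc y))))
  (≤-trans (≤-reflexive (∑-cong (allFin n) λ x →
     cong₂ (λ a b → ind (a ∧ b)) (≤ᵇ-suc (toℕ x) (toℕ y)) (≤ᵇ-suc (toℕ y) (toℕ x)))) (∑ᶠ-== y))

-- Sums over vectors and reversal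

∑ⱽ : ∀ l → (Vec (Fin n) l → ℕ) → ℕ
∑ⱽ {n} l = ∑ (allVecs n l)

∑ⱽ-suc : ∀ l (f : Vec (Fin n) (suc l) → ℕ) → ∑ⱽ (suc l) f ≡ ∑ⱽ l (λ v → ∑ᶠ (λ x → f (x ∷ v)))
∑ⱽ-suc {n} l f =
  trans (∑-concatMap (λ v → map (_∷ v) (allFin n)) (allVecs n l) f)
    (∑-cong (allVecs n l) (λ v → ∑-map (_∷ v) (allFin n) f))

-- `allVecs` grows vectors at the head. Induction peels off a first and a last entry, and exchanging
-- these two sums lets the vectors grow at the end instead.
∑ⱽ-∷ʳ : ∀ l (f : Vec (Fin n) (suc l) → ℕ) → ∑ⱽ (suc l) f ≡ ∑ⱽ l (λ v → ∑ᶠ (λ x → f (v ∷ʳ x)))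
∑ⱽ-∷ʳ zero    f = ∑ⱽ-suc zero f
∑ⱽ-∷ʳ {n} (suc l) f = begin
  ∑ⱽ (suc (suc l)) f
    ≡⟨ ∑ⱽ-suc (suc l) f ⟩
  ∑ⱽ (suc l) (λ v → ∑ᶠ (λ y → f (y ∷ v)))
    ≡⟨ ∑ⱽ-∷ʳ l _ ⟩
  ∑ⱽ l (λ w → ∑ᶠ (λ x → ∑ᶠ (λ y → f (y ∷ (w ∷ʳ x)))))
    ≡⟨ ∑-cong (allVecs n l) (λ w → ∑-swap (allFin n) (allFin n) (λ x y → f (y ∷ (w ∷ʳ x)))) ⟩
  ∑ⱽ l (λ w → ∑ᶠ (λ y → ∑ᶠ (λ x → f ((y ∷ w) ∷ʳ x))))
    ≡⟨ sym (∑ⱽ-suc l (λ v → ∑ᶠ (λ x → f (v ∷ʳ x)))) ⟩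
  ∑ⱽ (suc l) (λ v → ∑ᶠ (λ x → f (v ∷ʳ x))) ∎
  where open ≡-Reasoning

-- Reversal turns growth at the head into growth at the end, so `∑ⱽ-∷ʳ` absorbs it and no
-- permutation of `allVecs` has to be constructed.
∑ⱽ-reverse : ∀ l (f : Vec (Fin n) l → ℕ) → ∑ⱽ l (f ∘ reverse) ≡ ∑ⱽ l f
∑ⱽ-reverse zero    f = refl
∑ⱽ-reverse {n} (suc l) f = begin
  ∑ⱽ (suc l) (f ∘ reverse)
    ≡⟨ ∑ⱽ-suc l (f ∘ reverse) ⟩
  ∑ⱽ l (λ v → ∑ᶠ (λ x → f (reverse (x ∷ v))))
    ≡⟨ ∑-cong (allVecs n l) (λ v → ∑-cong (allFin n) (λ x → cong f (reverse-∷ x v))) ⟩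
  ∑ⱽ l (λ v → ∑ᶠ (λ x → f (reverse v ∷ʳ x)))
    ≡⟨ ∑ⱽ-reverse l (λ v → ∑ᶠ (λ x → f (v ∷ʳ x))) ⟩
  ∑ⱽ l (λ v → ∑ᶠ (λ x → f (v ∷ʳ x)))
    ≡⟨ sym (∑ⱽ-∷ʳ l f) ⟩
  ∑ⱽ (suc l) f ∎
  where open ≡-Reasoning

==-comm : (x y : Fin n) → (x == y) ≡ (y == x)
==-comm x y = ∧-comm (toℕ x ≤ᵇ toℕ y) (toℕ y ≤ᵇ toℕ x)

notIn-∷ʳ : (y : Fin n) (v : Vec (Fin n) l) (x : Fin n) →
  notIn y (v ∷ʳ x) ≡ notIn y v ∧ not (y == x)
notIn-∷ʳ y []      x = ∧-comm (not (y == x)) true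
notIn-∷ʳ y (z ∷ v) x = trans (cong (not (y == z) ∧_) (notIn-∷ʳ y v x))
  (sym (∧-assoc (not (y == z)) (notIn y v) (not (y == x))))

notIn-reverse : (y : Fin n) (v : Vec (Fin n) l) → notIn y (reverse v) ≡ notIn y v
notIn-reverse y []      = refl
notIn-reverse y (x ∷ v) rewrite reverse-∷ x v | notIn-∷ʳ y (reverse v) x | notIn-reverse y v =
  ∧-comm (notIn y v) (not (y == x))

distinct-∷ʳ : (v : Vec (Fin n) l) (x : Fin n) → distinct (v ∷ʳ x) ≡ distinct v ∧ notIn x v
distinct-∷ʳ []      x = refl
distinct-∷ʳ (y ∷ v) x rewrite notIn-∷ʳ y v x | distinct-∷ʳ v x | ==-comm x y =
  shuffle (notIn y v) (not (y == x)) (distinct v) (notIn x v)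
  where
  shuffle : ∀ a b c d → (a ∧ b) ∧ (c ∧ d) ≡ (a ∧ c) ∧ (b ∧ d)
  shuffle true  true  c     d = refl
  shuffle true  false true  d = refl
  shuffle true  false false d = refl
  shuffle false b     c     d = refl

distinct-reverse : (v : Vec (Fin n) l) → distinct (reverse v) ≡ distinct v
distinct-reverse []      = refl
distinct-reverse (x ∷ v)
  rewrite reverse-∷ x v | distinct-∷ʳ (reverse v) x | distinct-reverse v | notIn-reverse x v =
  ∧-comm (distinct v) (notIn x v)

endV : Vec (Fin n) (suc l) → Fin n
endV v = lastV (head v) (tail v)

lastV-∷ʳ : (y : Fin n) (v : Vec (Fin n) l) (x : Fin n) → lastV y (v ∷ʳ x) ≡ x
lastV-∷ʳ y []      x = refl
lastV-∷ʳ y (z ∷ v) x = lastV-∷ʳ z v x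

endV-∷ʳ : (v : Vec (Fin n) l) (x : Fin n) → endV (v ∷ʳ x) ≡ x
endV-∷ʳ []      x = refl
endV-∷ʳ (y ∷ v) x = lastV-∷ʳ y v x

head-∷ʳ : (v : Vec (Fin n) (suc l)) (x : Fin n) → head (v ∷ʳ x) ≡ head v
head-∷ʳ (y ∷ v) x = refl

endV-reverse : (v : Vec (Fin n) (suc l)) → endV (reverse v) ≡ head v
endV-reverse (x ∷ v) rewrite reverse-∷ x v = endV-∷ʳ (reverse v) x

head-reverse : (v : Vec (Fin n) (suc l)) → head (reverse v) ≡ endV v
head-reverse (x ∷ [])    = refl
head-reverse (x ∷ y ∷ v) rewrite reverse-∷ x (y ∷ v) =
  trans (head-∷ʳ (reverse (y ∷ v)) x) (head-reverse (y ∷ v))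

module _ (G : Graph n) where

  consecAdj-∷ʳ : (v : Vec (Fin n) (suc l)) (x : Fin n) →
    consecAdj G (v ∷ʳ x) ≡ consecAdj G v ∧ adj G (endV v) x
  consecAdj-∷ʳ (y ∷ [])    x = ∧-comm (adj G y x) true
  consecAdj-∷ʳ (y ∷ z ∷ v) x =
    trans (cong (adj G y z ∧_) (consecAdj-∷ʳ (z ∷ v) x))
      (sym (∧-assoc (adj G y z) (consecAdj G (z ∷ v)) _))

  consecAdj-reverse : (v : Vec (Fin n) l) → consecAdj G (reverse v) ≡ consecAdj G v
  consecAdj-reverse []          = refl
  consecAdj-reverse (x ∷ [])    = refl
  consecAdj-reverse (x ∷ y ∷ v) = begin
    consecAdj G (reverse (x ∷ y ∷ v))
      ≡⟨ cong (consecAdj G) (reverse-∷ x (y ∷ v)) ⟩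
    consecAdj G (reverse (y ∷ v) ∷ʳ x)
      ≡⟨ consecAdj-∷ʳ (reverse (y ∷ v)) x ⟩
    consecAdj G (reverse (y ∷ v)) ∧ adj G (endV (reverse (y ∷ v))) x
      ≡⟨ cong₂ _∧_ (consecAdj-reverse (y ∷ v))
           (trans (cong (λ z → adj G z x) (endV-reverse (y ∷ v))) (adj-sym G y x)) ⟩
    consecAdj G (y ∷ v) ∧ adj G x y
      ≡⟨ ∧-comm (consecAdj G (y ∷ v)) (adj G x y) ⟩
    adj G x y ∧ consecAdj G (y ∷ v) ∎
    where open ≡-Reasoning

-- Orientations of a path and injective walks

distinct-ends : (x y : Fin n) (v : Vec (Fin n) l) → notIn x (y ∷ v) ≡ true → (x == lastV y v) ≡ false
distinct-ends x y []      h with x == y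
... | false = refl
distinct-ends x y (z ∷ v) h with x == y
... | false = distinct-ends x z v h

trichotomy : ∀ i j → ((i ≤ᵇ j) ∧ (j ≤ᵇ i)) ≡ false → ind (i <ᵇ j) + ind (j <ᵇ i) ≡ 1
trichotomy zero    (suc j) h = refl
trichotomy (suc i) zero    h = refl
trichotomy (suc i) (suc j) h =
  trichotomy i j (trans (sym (cong₂ _∧_ (≤ᵇ-suc i j) (≤ᵇ-suc j i))) h)

injWalks : ∀ l → Graph n → ℕ
injWalks l G = ∑ⱽ l (λ v → ind (distinct v ∧ consecAdj G v))

-- Reversal exchanges the two orientations of a path.
NP-double : ∀ l (G : Graph n) → NP (suc (suc l)) G + NP (suc (suc l)) G ≡ injWalks (suc (suc l)) G
NP-double {n} l G = begin
  NP L G + NP L G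
    ≡⟨ cong₂ _+_ (countB≡∑ (isPathCopy G) (allVecs n L))
                 (trans (countB≡∑ (isPathCopy G) (allVecs n L)) (sym (∑ⱽ-reverse L _))) ⟩
  ∑ⱽ L (ind ∘ isPathCopy G) + ∑ⱽ L (λ v → ind (isPathCopy G (reverse v)))
    ≡⟨ sym (∑-+ (allVecs n L) _ _) ⟩
  ∑ⱽ L (λ v → ind (isPathCopy G v) + ind (isPathCopy G (reverse v)))
    ≡⟨ ∑-cong (allVecs n L) pointwise ⟩
  injWalks L G ∎
  where
  open ≡-Reasoning
  L : ℕ
  L = suc (suc l)
  oriented-head : (v : Vec (Fin n) L) → oriented v ≡ (toℕ (head v) <ᵇ toℕ (endV v))
  oriented-head (x ∷ v) = refl
  combine : ∀ d c a b → (d ≡ true → ind a + ind b ≡ 1) →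
    ind (d ∧ c ∧ a) + ind (d ∧ c ∧ b) ≡ ind (d ∧ c)
  combine true  true  a b h = h refl
  combine true  false a b h = refl
  combine false c     a b h = refl
  ends : (v : Vec (Fin n) L) → distinct v ≡ true →
    ind (toℕ (head v) <ᵇ toℕ (endV v)) + ind (toℕ (endV v) <ᵇ toℕ (head v)) ≡ 1
  ends (x ∷ y ∷ v) d with notIn x (y ∷ v) in h
  ... | true = trichotomy (toℕ x) (toℕ (lastV y v)) (distinct-ends x y v h)
  pointwise : (v : Vec (Fin n) L) →
    ind (isPathCopy G v) + ind (isPathCopy G (reverse v)) ≡ ind (distinct v ∧ consecAdj G v)
  pointwise v
    rewrite oriented-head v | oriented-head (reverse v) | distinct-reverse v
          | consecAdj-reverse G v | endV-reverse v | head-reverse v =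
    combine (distinct v) (consecAdj G v) _ _ (ends v)

-- Walks in triangle-free graphs

numEdges≡∑ : (G : Graph n) →
  numEdges G ≡ ∑ᶠ (λ i → ∑ᶠ (λ j → ind ((toℕ i <ᵇ toℕ j) ∧ adj G i j)))
numEdges≡∑ {n} G = trans (countB≡∑ _ (cartesianProduct (allFin n) (allFin n)))
  (∑-cartesianProduct (allFin n) (allFin n) _)

==⇒≡ : (x y : Fin n) → (x == y) ≡ true → x ≡ y
==⇒≡ zero    zero    h = refl
==⇒≡ (suc x) (suc y) h =
  cong suc (==⇒≡ x y (trans (sym (cong₂ _∧_ (≤ᵇ-suc (toℕ x) (toℕ y)) (≤ᵇ-suc (toℕ y) (toℕ x)))) h))

-- The second copy of the edge sum is transposed, so an adjacent pair is seen once in each order;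
-- irreflexivity removes the diagonal, where `trichotomy` would fail.
handshake : (G : Graph n) → ∑ᶠ (λ i → ∑ᶠ (λ j → ind (adj G i j))) ≡ numEdges G + numEdges G
handshake {n} G = sym (begin
  numEdges G + numEdges G
    ≡⟨ cong₂ _+_ (numEdges≡∑ G) (trans (numEdges≡∑ G) (∑-swap (allFin n) (allFin n) up)) ⟩
  ∑ᶠ (λ i → ∑ᶠ (up i)) + ∑ᶠ (λ i → ∑ᶠ (λ j → up j i))
    ≡⟨ sym (∑-+ (allFin n) _ _) ⟩
  ∑ᶠ (λ i → ∑ᶠ (up i) + ∑ᶠ (λ j → up j i))
    ≡⟨ ∑-cong (allFin n) (λ i → trans (sym (∑-+ (allFin n) _ _)) (∑-cong (allFin n) (pointwise i))) ⟩
  ∑ᶠ (λ i → ∑ᶠ (λ j → ind (adj G i j))) ∎)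
  where
  open ≡-Reasoning
  up : Fin n → Fin n → ℕ
  up i j = ind ((toℕ i <ᵇ toℕ j) ∧ adj G i j)
  combine : ∀ c a b → (c ≡ true → ind a + ind b ≡ 1) → ind (a ∧ c) + ind (b ∧ c) ≡ ind c
  combine true  a b h = trans (cong₂ _+_ (cong ind (∧-comm a true)) (cong ind (∧-comm b true))) (h refl)
  combine false a b h = cong₂ _+_ (cong ind (∧-comm a false)) (cong ind (∧-comm b false))
  irreflexive : ∀ i j → adj G i j ≡ true → (i == j) ≡ false
  irreflexive i j a with i == j in h
  ... | false = refl
  ... | true with ==⇒≡ i j h
  ...   | refl with trans (sym a) (irrefl G i)
  ...     | ()
  pointwise : ∀ i j → up i j + up j i ≡ ind (adj G i j)
  pointwise i j rewrite adj-sym G j i =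
    combine (adj G i j) (toℕ i <ᵇ toℕ j) (toℕ j <ᵇ toℕ i) (λ a → trichotomy (toℕ i) (toℕ j) (irreflexive i j a))

-- Repeated vertices are allowed: without distinctness, the number of ways to extend a walk depends
-- on its first vertex only.
walks : ∀ l → Graph n → ℕ
walks l G = ∑ⱽ l (λ v → ind (consecAdj G v))

injWalks≤walks : ∀ l (G : Graph n) → injWalks l G ≤ walks l G
injWalks≤walks {n} l G = ∑-mono (allVecs n l) (λ v → drop (distinct v) (consecAdj G v))
  where
  drop : ∀ a b → ind (a ∧ b) ≤ ind b
  drop true  b = ≤-refl
  drop false b = z≤n

module _ (G : Graph n) (triangle-free : TriangleFree G) where

  private
    a : Fin n → Fin n → ℕ
    a i j = ind (adj G i j)

  -- A vertex x is adjacent to at most one end of each edge zy; the two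
  -- orientations of the edge are summed together.
  pendant-edges : ∀ x → ∑ᶠ (λ y → ∑ᶠ (λ z → a z y * a y x)) ≤ numEdges G
  pendant-edges x = *-cancelˡ-≤ 2 (begin
    2 * h                                               ≡⟨ cong (h +_) (+-identityʳ h) ⟩
    h + h                                               ≡⟨ cong (h +_) (∑-swap (allFin n) (allFin n) _) ⟩
    h + ∑ᶠ (λ y → ∑ᶠ (λ z → a y z * a z x))             ≡⟨ sym (∑-+ (allFin n) _ _) ⟩
    ∑ᶠ (λ y → ∑ᶠ (λ z → a z y * a y x) + ∑ᶠ (λ z → a y z * a z x))
      ≤⟨ ∑-mono (allFin n) (λ y → ≤-trans (≤-reflexive (sym (∑-+ (allFin n) _ _)))
                                    (∑-mono (allFin n) (one-end y))) ⟩
    ∑ᶠ (λ y → ∑ᶠ (λ z → a y z))                         ≡⟨ handshake G ⟩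
    numEdges G + numEdges G                             ≡⟨ cong (numEdges G +_) (sym (+-identityʳ (numEdges G))) ⟩
    2 * numEdges G                                      ∎)
    where
    open ≤-Reasoning
    h : ℕ
    h = ∑ᶠ (λ y → ∑ᶠ (λ z → a z y * a y x))
    one-end : ∀ y z → a z y * a y x + a y z * a z x ≤ a y z
    one-end y z rewrite adj-sym G z y with adj G y z in yz | adj G y x in yx | adj G z x in zx
    ... | false | _     | _     = z≤n
    ... | true  | false | false = z≤n
    ... | true  | false | true  = ≤-refl
    ... | true  | true  | false = ≤-refl
    ... | true  | true  | true  = ⊥-elim (triangle-free y z x yz zx yx)

  -- Prepending `z` and `y` to a walk from `x` needs `z ~ y ~ x`, which `pendant-edges` bounds
  -- uniformly in `x`. The shorter walk must be nonempty for `x` to exist.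
  walks-step : ∀ l → walks (3 + l) G ≤ numEdges G * walks (suc l) G
  walks-step l = begin
    walks (3 + l) G
      ≡⟨ trans (∑ⱽ-suc (2 + l) _) (∑ⱽ-suc (1 + l) _) ⟩
    ∑ⱽ (suc l) (λ v → ∑ᶠ (λ y → ∑ᶠ (λ z → ind (consecAdj G (z ∷ y ∷ v)))))
      ≤⟨ ∑-mono (allVecs n (suc l)) extend ⟩
    ∑ⱽ (suc l) (λ v → numEdges G * ind (consecAdj G v))
      ≡⟨ ∑-*ˡ (numEdges G) (allVecs n (suc l)) _ ⟩
    numEdges G * walks (suc l) G ∎
    where
    open ≤-Reasoning
    extend : ∀ v → ∑ᶠ (λ y → ∑ᶠ (λ z → ind (consecAdj G (z ∷ y ∷ v)))) ≤ numEdges G * ind (consecAdj G v)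
    extend v@(x ∷ _) = begin
      ∑ᶠ (λ y → ∑ᶠ (λ z → ind (consecAdj G (z ∷ y ∷ v))))
        ≡⟨ ∑-cong (allFin n) (λ y → ∑-cong (allFin n) (λ z →
             trans (ind-∧ (adj G z y) _) (trans (cong (a z y *_) (ind-∧ (adj G y x) _))
               (sym (*-assoc (a z y) (a y x) _))))) ⟩
      ∑ᶠ (λ y → ∑ᶠ (λ z → a z y * a y x * c))
        ≡⟨ trans (∑-cong (allFin n) (λ y → ∑-*ʳ c (allFin n) _)) (∑-*ʳ c (allFin n) _) ⟩
      ∑ᶠ (λ y → ∑ᶠ (λ z → a z y * a y x)) * c
        ≤⟨ *-monoˡ-≤ c (pendant-edges x) ⟩
      numEdges G * c ∎
      where
      c : ℕ
      c = ind (consecAdj G v)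

-- In closed form `2 e^k` at `2k` and `n e^k` at `2k+1`. The value 2 at zero, although there is only
-- one empty walk, makes the value at two the number `2e` of ordered edges.
walkBound : (l n e : ℕ) → ℕ
walkBound zero          n e = 2
walkBound (suc zero)    n e = n
walkBound (suc (suc l)) n e = e * walkBound l n e

-- Steps of two from one vertex (exactly `n` walks) and two vertices (exactly `2e`, by `handshake`).
walks≤walkBound : (G : Graph n) → TriangleFree G → ∀ l → walks (suc l) G ≤ walkBound (suc l) n (numEdges G)
walks≤walkBound {n} G tf zero = ≤-reflexive
  (trans (∑ⱽ-suc {n} zero _) (trans (+-identityʳ _) (∑ᶠ-one {n})))
walks≤walkBound {n} G tf (suc zero) = ≤-reflexive (begin
  walks 2 G
    ≡⟨ trans (∑ⱽ-suc {n} 1 _) (trans (∑ⱽ-suc {n} 0 _) (+-identityʳ _)) ⟩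
  ∑ᶠ (λ y → ∑ᶠ (λ x → ind (adj G x y ∧ true)))
    ≡⟨ ∑-cong (allFin n) (λ y → ∑-cong (allFin n) (λ x →
         cong ind (trans (∧-comm (adj G x y) true) (adj-sym G x y)))) ⟩
  ∑ᶠ (λ y → ∑ᶠ (λ x → ind (adj G y x)))  ≡⟨ handshake G ⟩
  numEdges G + numEdges G                ≡⟨ cong (numEdges G +_) (sym (+-identityʳ (numEdges G))) ⟩
  2 * numEdges G                         ≡⟨ *-comm 2 (numEdges G) ⟩
  numEdges G * 2                         ∎)
  where open ≡-Reasoning
walks≤walkBound G tf (suc (suc l)) =
  ≤-trans (walks-step G tf l) (*-monoʳ-≤ (numEdges G) (walks≤walkBound G tf l))

-- The graph B

≡true-∧ : ∀ {x y} → x ≡ true → y ≡ true → (x ∧ y) ≡ true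
≡true-∧ refl refl = refl

∧-≡true : ∀ x {y} → (x ∧ y) ≡ true → x ≡ true × y ≡ true
∧-≡true true h = refl , h

module _ (n e : ℕ) (1≤t : 1 ≤ tPar n e) where

  private
    t d : ℕ
    t = tPar n e
    d = t * (n ∸ t) ∸ e

  -- Adjacent vertices lie on different sides of the cut at `t`, and among three vertices two share
  -- a side.
  B-triangle-free : TriangleFree (B n e)
  B-triangle-free i j k ij jk ik =
    two-coloured (toℕ i <ᵇ t) (toℕ j <ᵇ t) (toℕ k <ᵇ t)
      (proj₁ (∧-≡true _ ij)) (proj₁ (∧-≡true _ jk)) (proj₁ (∧-≡true _ ik))
    where
    two-coloured : ∀ α β γ → (α ∧ not β) ∨ (β ∧ not α) ≡ true → (β ∧ not γ) ∨ (γ ∧ not β) ≡ true →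
      (α ∧ not γ) ∨ (γ ∧ not α) ≡ true → ⊥
    two-coloured true  false true  _ _ ()
    two-coloured false true  false _ _ ()
    two-coloured true  true  _     () _ _
    two-coloured false false _     () _ _
    two-coloured true  false false _ () _
    two-coloured false true  true  _ () _

  module _ (t≤n : t ≤ n) (e≤t[n∸t] : e ≤ t * (n ∸ t)) (d≤n∸t : d ≤ n ∸ t) where

    -- Restoring the `d` deleted pairs gives every pair of the complete bipartite graph. The bound
    -- `d ≤ n ∸ t` makes the deleted neighbours `t, …, t+d-1` actual vertices.
    B-numEdges : numEdges (B n e) ≡ e
    B-numEdges = +-cancelʳ-≡ d _ _ (begin
      numEdges (B n e) + d
        ≡⟨ cong₂ _+_ (numEdges≡∑ (B n e)) (sym deleted-count) ⟩
      ∑ᶠ (λ i → ∑ᶠ (present i)) + ∑ᶠ (λ i → ∑ᶠ (deleted i))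
        ≡⟨ trans (sym (∑-+ (allFin n) _ _)) (∑-cong (allFin n) (λ i →
             trans (sym (∑-+ (allFin n) _ _)) (∑-cong (allFin n) (pointwise i)))) ⟩
      ∑ᶠ (λ i → ∑ᶠ (λ j → low i * high j))
        ≡⟨ ∑-product low high ⟩
      ∑ᶠ low * ∑ᶠ high
        ≡⟨ cong₂ _*_ (∑ᶠ-interval n z≤n t≤n) (∑ᶠ-≤ n t) ⟩
      t * (n ∸ t)
        ≡⟨ sym (m+[n∸m]≡n e≤t[n∸t]) ⟩
      e + d ∎)
      where
      open ≡-Reasoning
      low high : Fin n → ℕ
      low i  = ind (inInterval 0 t (toℕ i))
      high j = ind (t ≤ᵇ toℕ j)
      present deleted : Fin n → Fin n → ℕ
      present i j = ind ((toℕ i <ᵇ toℕ j) ∧ BAdj n e i j)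
      -- The deleted pairs form the rectangle of vertex 0 and an interval, so their number factors.
      deleted i j = ind (inInterval 0 1 (toℕ i)) * ind (inInterval t (t + d) (toℕ j))
      ∑-product : (f g : Fin n → ℕ) → ∑ᶠ (λ i → ∑ᶠ (λ j → f i * g j)) ≡ ∑ᶠ f * ∑ᶠ g
      ∑-product f g = trans (∑-cong (allFin n) (λ i → ∑-*ˡ (f i) (allFin n) g)) (∑-*ʳ (∑ᶠ g) (allFin n) f)
      deleted-count : ∑ᶠ (λ i → ∑ᶠ (deleted i)) ≡ d
      deleted-count = trans (∑-product _ _) (trans (cong₂ _*_ (∑ᶠ-interval n z≤n (≤-trans 1≤t t≤n))
        (∑ᶠ-interval n (m≤m+n t d) (≤-trans (+-monoʳ-≤ t d≤n∸t) (≤-reflexive (m+[n∸m]≡n t≤n)))))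
        (trans (+-identityʳ _) (m+n∸m≡n t d)))
      pointwise : ∀ i j → present i j + deleted i j ≡ low i * high j
      pointwise i′ j′ = on-ℕ (toℕ i′) (toℕ j′)
        where
        on-ℕ : ∀ i j →
          ind ((i <ᵇ j) ∧ (((i <ᵇ t) ∧ not (j <ᵇ t)) ∨ ((j <ᵇ t) ∧ not (i <ᵇ t)))
            ∧ not (((i ≤ᵇ 0) ∧ (j <ᵇ t + d)) ∨ ((j ≤ᵇ 0) ∧ (i <ᵇ t + d))))
          + ind (i <ᵇ 1) * ind ((t ≤ᵇ j) ∧ (j <ᵇ t + d)) ≡ ind (i <ᵇ t) * ind (t ≤ᵇ j)
        -- The type is `BAdj` unfolded over naturals. Both sides are zero except when `i < t ≤ j`.
        on-ℕ i j rewrite ≤ᵇ-not-<ᵇ i 0 | ≤ᵇ-not-<ᵇ j 0 with i <? t | j <? t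
        ... | yes i<t | yes j<t
          rewrite <ᵇ-true i<t | <ᵇ-true j<t | ≤ᵇ-false j<t | ∧-comm (i <ᵇ j) false = *-zeroʳ (ind (i <ᵇ 1))
        ... | no i≮t  | no j≮t
          rewrite <ᵇ-false (≮⇒≥ i≮t) | <ᵇ-false (≮⇒≥ j≮t) | ∧-comm (i <ᵇ j) false
                | <ᵇ-false (≤-trans 1≤t (≮⇒≥ i≮t)) = refl
        ... | no i≮t  | yes j<t
          rewrite <ᵇ-false (≮⇒≥ i≮t) | <ᵇ-true j<t | <ᵇ-false (≤-trans (<⇒≤ j<t) (≮⇒≥ i≮t))
                | <ᵇ-false (≤-trans 1≤t (≮⇒≥ i≮t)) = refl
        ... | yes i<t | no j≮t
          rewrite <ᵇ-true i<t | <ᵇ-false (≮⇒≥ j≮t) | <ᵇ-true (<-≤-trans i<t (≮⇒≥ j≮t))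
                | ≤ᵇ-true (≮⇒≥ j≮t) | <ᵇ-true (≤-trans 1≤t (≮⇒≥ j≮t)) = merge i (j <ᵇ t + d)
          where
          -- A pair across the cut is either kept or deleted, and deleted only if `i` is 0.
          merge : ∀ i γ → ind (not ((not (0 <ᵇ i) ∧ γ) ∨ false)) + ind (i <ᵇ 1) * ind γ ≡ 1
          merge zero    true  = refl
          merge zero    false = refl
          merge (suc i) γ     = refl

  -- Vertex 0, which may have lost edges, belongs to neither part.
  inPart : Bool → Fin n → Bool
  inPart true  x = inInterval 1 t (toℕ x)
  inPart false x = t ≤ᵇ toℕ x

  inPart-disjoint : ∀ x → inPart true x ≡ true → inPart false x ≡ false
  inPart-disjoint x h = ≤ᵇ-false (<ᵇ⇒< (toℕ x) t (≡true⇒T (proj₂ (∧-≡true (1 ≤ᵇ toℕ x) h))))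

  -- Both vertices are nonzero, since the far part starts at `t ≥ 1`; hence no deletion touches the
  -- pair and crossing the cut suffices.
  inPart-adj : ∀ c x y → inPart c x ≡ true → inPart (not c) y ≡ true → BAdj n e x y ≡ true
  inPart-adj true x y hx hy = cross
    (≤ᵇ⇒≤ 1 (toℕ x) (≡true⇒T (proj₁ (∧-≡true (1 ≤ᵇ toℕ x) hx))))
    (<ᵇ⇒< (toℕ x) t (≡true⇒T (proj₂ (∧-≡true (1 ≤ᵇ toℕ x) hx))))
    (≤ᵇ⇒≤ t (toℕ y) (≡true⇒T hy))
    where
    cross : 1 ≤ toℕ x → toℕ x < t → t ≤ toℕ y → BAdj n e x y ≡ true
    cross 1≤x x<t t≤y
      rewrite <ᵇ-true x<t | <ᵇ-false t≤y | ≤ᵇ-false 1≤x | ≤ᵇ-false (≤-trans 1≤t t≤y) = refl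
  inPart-adj false x y hx hy = trans (BAdj-sym n e x y) (inPart-adj true y x hy hx)

  -- Alternating paths in `B`

  partSize : Bool → ℕ
  partSize true  = t ∸ 1
  partSize false = n ∸ t

  inPart-count : t ≤ n → ∀ c → ∑ᶠ (λ x → ind (inPart c x)) ≡ partSize c
  inPart-count t≤n true  = ∑ᶠ-interval n 1≤t t≤n
  inPart-count t≤n false = ∑ᶠ-≤ n t

  alternating : Bool → Vec (Fin n) l → Bool
  alternating c []      = true
  alternating c (x ∷ v) = inPart c x ∧ alternating (not c) v

  alternating-consecAdj : ∀ c (v : Vec (Fin n) l) → alternating c v ≡ true → consecAdj (B n e) v ≡ true
  alternating-consecAdj c []          h = refl
  alternating-consecAdj c (x ∷ [])    h = refl
  alternating-consecAdj c (x ∷ y ∷ v) h =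
    ≡true-∧ (inPart-adj c x y (proj₁ hs) (proj₁ (∧-≡true (inPart (not c) y) (proj₂ hs))))
            (alternating-consecAdj (not c) (y ∷ v) (proj₂ hs))
    where
    hs : inPart c x ≡ true × alternating (not c) (y ∷ v) ≡ true
    hs = ∧-≡true (inPart c x) h

  altPaths : ∀ l → Bool → ℕ
  altPaths l c = ∑ⱽ l (λ v → ind (distinct v ∧ alternating c v))

  -- The part of the first vertex tells the two families apart. Hence the length `suc l`: the empty
  -- vector would be counted twice.
  altPaths≤injWalks : ∀ l → altPaths (suc l) true + altPaths (suc l) false ≤ injWalks (suc l) (B n e)
  altPaths≤injWalks l = ≤-trans (≤-reflexive (sym (∑-+ (allVecs n (suc l)) _ _)))
    (∑-mono (allVecs n (suc l)) (λ v → exclusive (distinct v)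
      (alternating-consecAdj true v) (alternating-consecAdj false v) (disjoint v)))
    where
    exclusive : ∀ δ {α β γ} → (α ≡ true → γ ≡ true) → (β ≡ true → γ ≡ true) → (α ≡ true → β ≡ false) →
      ind (δ ∧ α) + ind (δ ∧ β) ≤ ind (δ ∧ γ)
    exclusive false p q r = z≤n
    exclusive true {true}          p q r rewrite p refl | r refl = ≤-refl
    exclusive true {false} {true}  p q r rewrite q refl = ≤-refl
    exclusive true {false} {false} p q r = z≤n
    disjoint : (v : Vec (Fin n) (suc l)) → alternating true v ≡ true → alternating false v ≡ false
    disjoint (x ∷ v) h rewrite inPart-disjoint x (proj₁ (∧-≡true (inPart true x) h)) = refl

  module _ (t≤n : t ≤ n) where

    -- Each entry of `v` rules out at most one vertex. The additive form lets the induction run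
    -- without truncated subtraction.
    fresh-count : ∀ c (v : Vec (Fin n) l) →
      partSize c ≤ ∑ᶠ (λ x → ind (inPart c x ∧ notIn x v)) + l
    fresh-count c [] = ≤-reflexive (trans (sym (inPart-count t≤n c))
      (trans (∑-cong (allFin n) (λ x → cong ind (∧-comm true (inPart c x)))) (sym (+-identityʳ _))))
    fresh-count {suc l} c (y ∷ v) = begin
      partSize c
        ≤⟨ fresh-count c v ⟩
      ∑ᶠ (λ x → ind (inPart c x ∧ notIn x v)) + l
        ≤⟨ +-monoˡ-≤ l (∑-mono (allFin n) (λ x → split (inPart c x) (x == y) (notIn x v))) ⟩
      ∑ᶠ (λ x → ind (inPart c x ∧ notIn x (y ∷ v)) + ind (x == y)) + l
        ≡⟨ cong (_+ l) (∑-+ (allFin n) _ _) ⟩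
      ∑ᶠ (λ x → ind (inPart c x ∧ notIn x (y ∷ v))) + ∑ᶠ (λ x → ind (x == y)) + l
        ≤⟨ +-monoˡ-≤ l (+-monoʳ-≤ _ (∑ᶠ-== y)) ⟩
      ∑ᶠ (λ x → ind (inPart c x ∧ notIn x (y ∷ v))) + 1 + l
        ≡⟨ +-assoc _ 1 l ⟩
      ∑ᶠ (λ x → ind (inPart c x ∧ notIn x (y ∷ v))) + suc l ∎
      where
      open ≤-Reasoning
      split : ∀ a b c → ind (a ∧ c) ≤ ind (a ∧ (not b ∧ c)) + ind b
      split false b     c = z≤n
      split true  true  c = ind≤1 c
      split true  false c = m≤m+n (ind c) 0

    altPaths-suc : ∀ l c → (partSize c ∸ l) * altPaths l (not c) ≤ altPaths (suc l) c
    altPaths-suc l c = begin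
      (partSize c ∸ l) * altPaths l (not c)
        ≡⟨ sym (∑-*ˡ (partSize c ∸ l) (allVecs n l) _) ⟩
      ∑ⱽ l (λ v → (partSize c ∸ l) * w v)
        ≤⟨ ∑-mono (allVecs n l) (λ v → *-monoˡ-≤ (w v)
             (m≤n+o⇒m∸n≤o (partSize c) l (≤-trans (fresh-count c v) (≤-reflexive (+-comm _ l))))) ⟩
      ∑ⱽ l (λ v → ∑ᶠ (λ x → ind (inPart c x ∧ notIn x v)) * w v)
        ≡⟨ ∑-cong (allVecs n l) (λ v → trans (sym (∑-*ʳ (w v) (allFin n) _))
             (∑-cong (allFin n) (λ x → trans (sym (ind-∧ (inPart c x ∧ notIn x v) _))
               (cong ind (shuffle (inPart c x) (notIn x v) (distinct v) _))))) ⟩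
      ∑ⱽ l (λ v → ∑ᶠ (λ x → ind (distinct (x ∷ v) ∧ alternating c (x ∷ v))))
        ≡⟨ sym (∑ⱽ-suc l _) ⟩
      altPaths (suc l) c ∎
      where
      open ≤-Reasoning
      w : Vec (Fin n) l → ℕ
      w v = ind (distinct v ∧ alternating (not c) v)
      shuffle : ∀ a b c d → (a ∧ b) ∧ (c ∧ d) ≡ (b ∧ c) ∧ (a ∧ d)
      shuffle true  true  c     d = refl
      shuffle true  false c     d = refl
      shuffle false true  true  d = refl
      shuffle false true  false d = refl
      shuffle false false c     d = refl

-- The parameter t and the asymptotic comparison

-- The witness `m` passes the test and lies within the fuel, so the search stops by `m` and never
-- returns its default `n`. The last component is minimality at the predecessor of the result,
-- restricted to `k ≤ u` because smaller values are never tested.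
search-spec : ∀ n e m k fuel → k ≤ m → m < k + fuel → e ≤ m * (n ∸ m) →
  k ≤ search n e k fuel × search n e k fuel ≤ m
  × e ≤ search n e k fuel * (n ∸ search n e k fuel)
  × (∀ u → search n e k fuel ≡ suc u → k ≤ u → u * (n ∸ u) < e)
search-spec n e m k zero k≤m m<k+0 _ =
  ⊥-elim (≤⇒≯ k≤m (≤-trans m<k+0 (≤-reflexive (+-identityʳ k))))
search-spec n e m k (suc fuel) k≤m m<k+fuel em with e ≤ᵇ k * (n ∸ k) in eq
... | true  = ≤-refl , k≤m , ≤ᵇ⇒≤ e _ (≡true⇒T eq)
            , λ u k≡1+u k≤u → ⊥-elim (≤⇒≯ k≤u (≤-reflexive (sym k≡1+u)))
... | false = let 1+k≤t , t≤m , et , below = search-spec n e m (suc k) fuel k<m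
                    (≤-trans m<k+fuel (≤-reflexive (+-suc k fuel))) em
              in <⇒≤ 1+k≤t , t≤m , et , λ u t≡1+u k≤u → case-u below u t≡1+u (m≤n⇒m<n∨m≡n k≤u)
  where
  k-fails : k * (n ∸ k) < e
  k-fails = ≰⇒> λ e≤ → true≢false (trans (sym (≤ᵇ-true e≤)) eq)
    where
    true≢false : true ≡ false → ⊥
    true≢false ()
  k<m : k < m
  k<m = ≤∧≢⇒< k≤m λ { refl → ≤⇒≯ em k-fails }
  -- The predecessor is either `k`, which has just failed, or a value covered by the recursive call.
  case-u : (∀ u → search n e (suc k) fuel ≡ suc u → suc k ≤ u → u * (n ∸ u) < e) →
    ∀ u → search n e (suc k) fuel ≡ suc u → k < u ⊎ k ≡ u → u * (n ∸ u) < e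
  case-u below u t≡1+u (inj₁ k<u)  = below u t≡1+u k<u
  case-u below u t≡1+u (inj₂ refl) = k-fails

halve : ∀ n → ∃[ h ] (n ≡ h + h ⊎ n ≡ suc (h + h))
halve zero = 0 , inj₁ refl
halve (suc n) with halve n
... | h , inj₁ n≡ = h , inj₂ (cong suc n≡)
... | h , inj₂ n≡ = suc h , inj₁ (cong suc (trans n≡ (sym (+-suc h h))))

-- Take `h = ⌊n/2⌋`, for which `h (n - h) = ⌊n²/4⌋`. For odd `n` the square exceeds `4 h (h + 1)` by
-- one, and integrality of `e` absorbs this.
balanced-cut : ∀ n e → 4 * e ≤ n * n → ∃[ h ] (h + h ≤ n × n ≤ suc (h + h) × e ≤ h * (n ∸ h))
balanced-cut n e 4e≤n² with halve n
... | h , inj₁ refl = h , ≤-refl , n≤1+n _ ,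
  subst (λ s → e ≤ h * s) (sym (m+n∸m≡n h h))
    (*-cancelˡ-≤ 4 (≤-trans 4e≤n² (≤-reflexive (square h))))
  where
  square : ∀ h → (h + h) * (h + h) ≡ 4 * (h * h)
  square = solve-∀
... | h , inj₂ refl = h , n≤1+n _ , ≤-refl ,
  subst (λ s → e ≤ h * s) (sym (trans (cong (_∸ h) (sym (+-suc h h))) (m+n∸m≡n h (suc h))))
    (≤-pred (*-cancelˡ-< 4 e (suc (h * suc h)) (begin-strict
      4 * e                         ≤⟨ 4e≤n² ⟩
      suc (h + h) * suc (h + h)     ≡⟨ square h ⟩
      1 + 4 * (h * suc h)           <⟨ +-monoˡ-< (4 * (h * suc h)) {1} {4} (s≤s (s≤s z≤n)) ⟩
      4 + 4 * (h * suc h)           ≡⟨ sym (*-suc 4 (h * suc h)) ⟩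
      4 * suc (h * suc h)           ∎)))
  where
  open ≤-Reasoning
  square : ∀ h → suc (h + h) * suc (h + h) ≡ 1 + 4 * (h * suc h)
  square = solve-∀

record CutBounds (n e M : ℕ) : Set where
  t : ℕ
  t = tPar n e
  field
    M≤t       : M ≤ t
    t≤n∸t     : t ≤ n ∸ t
    t≤n       : t ≤ n
    e≤t[n∸t]  : e ≤ t * (n ∸ t)
    d≤n∸t     : t * (n ∸ t) ∸ e ≤ n ∸ t

-- The balanced cut passes the test, so `t` is at most `n/2`. The bound `M ≤ t` follows from
-- `M n ≤ e ≤ t (n - t) ≤ t n`, and `d ≤ n ∸ t` from minimality of `t`.
tPar-bounds : ∀ n e M → 2 ≤ n → 2 ≤ M → 4 * e ≤ n * n → M * n ≤ e → CutBounds n e M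
tPar-bounds n e M 2≤n 2≤M 4e≤n² Mn≤e with balanced-cut n e 4e≤n²
... | zero , _ , n≤1 , _ = ⊥-elim (≤⇒≯ n≤1 2≤n)
... | h@(suc _) , 2h≤n , _ , eh = bounds (search-spec n e h 1 n (s≤s z≤n) (s≤s (≤-trans (m≤m+n h h) 2h≤n)) eh)
  where
  bounds : 1 ≤ tPar n e × tPar n e ≤ h × e ≤ tPar n e * (n ∸ tPar n e)
    × (∀ u → tPar n e ≡ suc u → 1 ≤ u → u * (n ∸ u) < e) → CutBounds n e M
  bounds (_ , t≤h , et , below) = record
    { M≤t = M≤t
    ; t≤n∸t = m+n≤o⇒m≤o∸n (tPar n e) 2t≤n
    ; t≤n = t≤n
    ; e≤t[n∸t] = et
    ; d≤n∸t = deleted (tPar n e) refl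
    }
    where
    2t≤n : tPar n e + tPar n e ≤ n
    2t≤n = ≤-trans (+-mono-≤ t≤h t≤h) 2h≤n
    t≤n : tPar n e ≤ n
    t≤n = ≤-trans (m≤m+n _ _) 2t≤n
    M≤t : M ≤ tPar n e
    M≤t = *-cancelʳ-≤ M (tPar n e) n ⦃ >-nonZero (<⇒≤ 2≤n) ⦄
      (≤-trans Mn≤e (≤-trans et (*-monoʳ-≤ (tPar n e) (m∸n≤m n (tPar n e)))))
    deleted : ∀ t → tPar n e ≡ t → t * (n ∸ t) ∸ e ≤ n ∸ t
    deleted zero    _    = ≤-trans (m∸n≤m 0 e) z≤n
    -- Minimality gives `u s ≤ u (n - u) < e`, so `t s = s + u s` exceeds `e` by at most `s`. It
    -- applies since `t ≥ M ≥ 2` puts `u` within the range searched from 1.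
    deleted (suc u) t≡1+u = m≤n+o⇒m∸n≤o (suc u * s) e (begin
      s + u * s              ≤⟨ +-monoʳ-≤ s (*-monoʳ-≤ u (∸-monoʳ-≤ n (n≤1+n u))) ⟩
      s + u * (n ∸ u)        ≤⟨ +-monoʳ-≤ s (<⇒≤ (below u t≡1+u 1≤u)) ⟩
      s + e                  ≡⟨ +-comm s e ⟩
      e + s                  ∎)
      where
      open ≤-Reasoning
      s : ℕ
      s = n ∸ suc u
      1≤u : 1 ≤ u
      1≤u = ≤-pred (≤-trans 2≤M (≤-trans M≤t (≤-reflexive t≡1+u)))

-- Injective walks in `B` against the walk bound

module _ (a k n e : ℕ) (1≤t : 1 ≤ tPar n e) (bounds : CutBounds n e (a + k)) where
  open CutBounds bounds

  sideSize : Bool → ℕ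
  sideSize true  = t
  sideSize false = n ∸ t

  -- The number of alternating `j`-vertex walks from side `c` in the full complete bipartite graph,
  -- vertex 0 included and repetitions allowed.
  sideProduct : ℕ → Bool → ℕ
  sideProduct zero    c = 1
  sideProduct (suc j) c = sideSize c * sideProduct j (not c)

  sideSize-large : ∀ c → a + k ≤ sideSize c
  sideSize-large true  = M≤t
  sideSize-large false = ≤-trans M≤t t≤n∸t

  sideSize≤partSize : ∀ c → sideSize c ≤ suc (partSize n e 1≤t c)
  sideSize≤partSize true  = ≤-reflexive (sym (m+[n∸m]≡n 1≤t))
  sideSize≤partSize false = n≤1+n _

  -- Vertex 0 and `j` used vertices cost at most `j + 1 ≤ k` choices, and a side of size `s ≥ a + k`
  -- satisfies `(s - k)/s ≥ a/(a + k)`.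
  sideSize-ratio : ∀ c j → j < k → a * sideSize c ≤ (a + k) * (partSize n e 1≤t c ∸ j)
  sideSize-ratio c j j<k = begin
    a * sideSize c                        ≡⟨ cong (a *_) (sym (m+[n∸m]≡n k≤size)) ⟩
    a * (k + r)                           ≡⟨ *-distribˡ-+ a k r ⟩
    a * k + a * r                         ≤⟨ +-monoˡ-≤ (a * r) (*-monoˡ-≤ k a≤r) ⟩
    r * k + a * r                         ≡⟨ collect r k a ⟩
    (a + k) * r                           ≤⟨ *-monoʳ-≤ (a + k) r≤ ⟩
    (a + k) * (partSize n e 1≤t c ∸ j)    ∎
    where
    open ≤-Reasoning
    r : ℕ
    r = sideSize c ∸ k
    k≤size : k ≤ sideSize c
    k≤size = ≤-trans (m≤n+m k a) (sideSize-large c)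
    a≤r : a ≤ r
    a≤r = m+n≤o⇒m≤o∸n a (sideSize-large c)
    r≤ : r ≤ partSize n e 1≤t c ∸ j
    r≤ = ≤-trans (∸-monoʳ-≤ (sideSize c) j<k) (∸-monoˡ-≤ (suc j) (sideSize≤partSize c))
    collect : ∀ r k a → r * k + a * r ≡ (a + k) * r
    collect = solve-∀

  -- Each of the `j` vertices costs one factor `a/(a + k)`, by `sideSize-ratio` and `altPaths-suc`.
  altPaths-lower : ∀ j → j ≤ k → ∀ c → a ^ j * sideProduct j c ≤ (a + k) ^ j * altPaths n e 1≤t j c
  altPaths-lower zero    _   c = ≤-refl
  altPaths-lower (suc j) j<k c = begin
    a ^ suc j * (sideSize c * sideProduct j (not c))
      ≡⟨ swap a (a ^ j) (sideSize c) (sideProduct j (not c)) ⟩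
    (a * sideSize c) * (a ^ j * sideProduct j (not c))
      ≤⟨ *-mono-≤ (sideSize-ratio c j j<k) (altPaths-lower j (<⇒≤ j<k) (not c)) ⟩
    ((a + k) * (partSize n e 1≤t c ∸ j)) * ((a + k) ^ j * altPaths n e 1≤t j (not c))
      ≡⟨ sym (swap (a + k) ((a + k) ^ j) _ _) ⟩
    (a + k) ^ suc j * ((partSize n e 1≤t c ∸ j) * altPaths n e 1≤t j (not c))
      ≤⟨ *-monoʳ-≤ ((a + k) ^ suc j) (altPaths-suc n e 1≤t t≤n j c) ⟩
    (a + k) ^ suc j * altPaths n e 1≤t (suc j) c ∎
    where
    open ≤-Reasoning
    swap : ∀ a b c d → (a * b) * (c * d) ≡ (a * c) * (b * d)
    swap = solve-∀

  -- Two more vertices multiply both products by `t (n - t) ≥ e`; the recursion starts from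
  -- `2 = 1 + 1` and `n = t + (n - t)`.
  walkBound≤sideProduct : ∀ j → walkBound j n e ≤ sideProduct j true + sideProduct j false
  walkBound≤sideProduct zero       = ≤-refl
  walkBound≤sideProduct (suc zero) = ≤-reflexive (trans (sym (m+[n∸m]≡n t≤n))
    (sym (cong₂ _+_ (*-identityʳ t) (*-identityʳ (n ∸ t)))))
  walkBound≤sideProduct (suc (suc j)) = ≤-trans (*-mono-≤ e≤t[n∸t] (walkBound≤sideProduct j))
    (≤-reflexive (distribute t (n ∸ t) (sideProduct j true) (sideProduct j false)))
    where
    distribute : ∀ t s x y → t * s * (x + y) ≡ t * (s * x) + s * (t * y)
    distribute = solve-∀

  -- The counterpart of `walks≤walkBound`: `B` attains the bound up to the factor
  -- `(a/(a + k))^(j+1)`.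
  walkBound≤injWalks : ∀ j → suc j ≤ k →
    a ^ suc j * walkBound (suc j) n e ≤ (a + k) ^ suc j * injWalks (suc j) (B n e)
  walkBound≤injWalks j j<k = begin
    a ^ suc j * walkBound (suc j) n e
      ≤⟨ *-monoʳ-≤ (a ^ suc j) (walkBound≤sideProduct (suc j)) ⟩
    a ^ suc j * (sideProduct (suc j) true + sideProduct (suc j) false)
      ≡⟨ *-distribˡ-+ (a ^ suc j) _ _ ⟩
    a ^ suc j * sideProduct (suc j) true + a ^ suc j * sideProduct (suc j) false
      ≤⟨ +-mono-≤ (altPaths-lower (suc j) j<k true) (altPaths-lower (suc j) j<k false) ⟩
    (a + k) ^ suc j * altPaths n e 1≤t (suc j) true + (a + k) ^ suc j * altPaths n e 1≤t (suc j) false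
      ≡⟨ sym (*-distribˡ-+ ((a + k) ^ suc j) _ _) ⟩
    (a + k) ^ suc j * (altPaths n e 1≤t (suc j) true + altPaths n e 1≤t (suc j) false)
      ≤⟨ *-monoʳ-≤ ((a + k) ^ suc j) (altPaths≤injWalks n e 1≤t j) ⟩
    (a + k) ^ suc j * injWalks (suc j) (B n e) ∎
    where open ≤-Reasoning

-- Bernoulli's inequality (1 - k/M)^j ≥ 1 - jk/M for M = a + k, with denominators cleared
bernoulli : ∀ a k j → (a + k) * (a + k) ^ j ≤ (a + k) * a ^ j + j * k * (a + k) ^ j
bernoulli a k zero    = m≤m+n ((a + k) * 1) 0
bernoulli a k (suc j) = begin
  M * (M * M ^ j)                                   ≤⟨ *-monoʳ-≤ M (bernoulli a k j) ⟩
  M * (M * a ^ j + j * k * M ^ j)                   ≡⟨ expand a k (a ^ j) (M ^ j) j ⟩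
  M * (a * a ^ j) + k * (M * a ^ j) + j * k * (M * M ^ j)
    ≤⟨ +-monoˡ-≤ (j * k * (M * M ^ j)) (+-monoʳ-≤ (M * (a * a ^ j))
         (*-monoʳ-≤ k (*-monoʳ-≤ M (^-monoˡ-≤ j (m≤m+n a k))))) ⟩
  M * (a * a ^ j) + k * (M * M ^ j) + j * k * (M * M ^ j)
    ≡⟨ collect (M * (a * a ^ j)) k (M * M ^ j) j ⟩
  M * (a * a ^ j) + suc j * k * (M * M ^ j) ∎
  where
  open ≤-Reasoning
  M : ℕ
  M = a + k
  expand : ∀ a k x y j → (a + k) * ((a + k) * x + j * k * y)
    ≡ (a + k) * (a * x) + k * ((a + k) * x) + j * k * ((a + k) * y)
  expand = solve-∀
  collect : ∀ w k y j → w + k * y + j * k * y ≡ w + (k + j * k) * y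
  collect = solve-∀

-- With `M = a + k`, `bernoulli` gives `(a/M)^k ≥ 1 - k²/M`. The choice of `a` makes `k²/M` at most
-- `1/(q + p)`, hence at most `p/(q + p)`, which leaves `q/(q + p)`.
ratio-power : ∀ p q k → 1 ≤ p → 1 ≤ k →
  let a = (q + p) * (k * k) in q * (a + k) ^ k ≤ (q + p) * a ^ k
ratio-power p q k 1≤p 1≤k =
  *-cancelˡ-≤ M ⦃ >-nonZero (≤-trans 1≤k (m≤n+m k a)) ⦄
    (+-cancelʳ-≤ (M * Mᵏ) _ _ (begin
    M * (q * Mᵏ) + M * Mᵏ
      -- Here `p ≥ 1` pays for the term `M * Mᵏ` added to both sides in place of a subtraction.
      ≤⟨ +-monoʳ-≤ (M * (q * Mᵏ)) (≤-trans (≤-reflexive (sym (+-identityʳ _))) (*-monoˡ-≤ (M * Mᵏ) 1≤p)) ⟩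
    M * (q * Mᵏ) + p * (M * Mᵏ)
      ≡⟨ collect M q p Mᵏ ⟩
    (q + p) * (M * Mᵏ)
      ≤⟨ *-monoʳ-≤ (q + p) (bernoulli a k k) ⟩
    (q + p) * (M * a ^ k + k * k * Mᵏ)
      ≡⟨ expand (q + p) M (a ^ k) (k * k) Mᵏ ⟩
    M * ((q + p) * a ^ k) + a * Mᵏ
      ≤⟨ +-monoʳ-≤ (M * ((q + p) * a ^ k)) (*-monoˡ-≤ Mᵏ (m≤m+n a k)) ⟩
    M * ((q + p) * a ^ k) + M * Mᵏ ∎))
  where
  open ≤-Reasoning
  a M Mᵏ : ℕ
  a = (q + p) * (k * k)
  M = a + k
  Mᵏ = M ^ k
  collect : ∀ M q p y → M * (q * y) + p * (M * y) ≡ (q + p) * (M * y)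
  collect = solve-∀
  expand : ∀ r M x s y → r * (M * x + s * y) ≡ M * (r * x) + r * s * y
  expand = solve-∀

theorem4p1 : (l : ℕ) → 2 ≤ l →
    (e : ℕ → ℕ) →
    (∀ n → 4 * e n ≤ n * n) →
    (∀ M → ∃[ N₀ ] (∀ n → N₀ ≤ n → M * n ≤ e n)) →
    (p q : ℕ) → 1 ≤ p → 1 ≤ q →
    ∃[ N₀ ] (∀ n → N₀ ≤ n →
    ((G : Graph n) → TriangleFree G → numEdges G ≡ e n →
    q * NP l G ≤ (q + p) * NP l (B n (e n)))
    ×
    (Σ (Graph n) λ G → (TriangleFree G × numEdges G ≡ e n ×
    q * NP l (B n (e n)) ≤ (q + p) * NP l G)))
theorem4p1 (suc zero) (s≤s ())
theorem4p1 k@(suc (suc l)) 2≤k e 4e≤n² superlinear p q 1≤p 1≤q =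
  -- `M` depends only on `p`, `q` and `k`, so superlinearity is used once; the extra 2 secures
  -- `n ≥ 2` for `tPar-bounds`.
  proj₁ (superlinear M) + 2 , λ n N₀+2≤n →
    let bounds = tPar-bounds n (e n) M (≤-trans (m≤n+m 2 _) N₀+2≤n) 2≤M (4e≤n² n)
                   (proj₂ (superlinear M) n (≤-trans (m≤m+n _ 2) N₀+2≤n))
        open CutBounds bounds
        1≤t = ≤-trans (<⇒≤ 2≤M) M≤t
    in (λ G tf edges → upper n bounds 1≤t G tf edges)
     -- `B` itself is admissible, so the lower bound on the maximum holds with room to spare.
     , B n (e n) , B-triangle-free n (e n) 1≤t
     , B-numEdges n (e n) 1≤t t≤n e≤t[n∸t] d≤n∸t
     , *-monoˡ-≤ (NP k (B n (e n))) (m≤m+n q p)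
  where
  a M : ℕ
  a = (q + p) * (k * k)
  M = a + k
  2≤M : 2 ≤ M
  2≤M = ≤-trans 2≤k (m≤n+m k a)
  upper : ∀ n → CutBounds n (e n) M → 1 ≤ tPar n (e n) →
    (G : Graph n) → TriangleFree G → numEdges G ≡ e n → q * NP k G ≤ (q + p) * NP k (B n (e n))
  -- The factor 2 turns copies into injective walks by `NP-double`, and `M ^ k` clears the
  -- denominator of `(a/M)^k`.
  upper n bounds 1≤t G tf edges = *-cancelˡ-≤ (2 * M ^ k) ⦃ 2Mᵏ≢0 ⦄ (begin
    2 * M ^ k * (q * NP k G)
      ≡⟨ regroup (M ^ k) q (NP k G) ⟩
    q * M ^ k * (NP k G + NP k G)
      ≤⟨ *-mono-≤ (ratio-power p q k 1≤p (s≤s z≤n)) (≤-trans (≤-reflexive (NP-double l G))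
           (≤-trans (injWalks≤walks k G) (≤-trans (walks≤walkBound G tf (suc l))
             (≤-reflexive (cong (walkBound k n) edges))))) ⟩
    (q + p) * a ^ k * walkBound k n (e n)
      ≡⟨ *-assoc (q + p) (a ^ k) _ ⟩
    (q + p) * (a ^ k * walkBound k n (e n))
      ≤⟨ *-monoʳ-≤ (q + p) (walkBound≤injWalks a k n (e n) 1≤t bounds (suc l) ≤-refl) ⟩
    (q + p) * (M ^ k * injWalks k (B n (e n)))
      ≡⟨ cong (λ x → (q + p) * (M ^ k * x)) (sym (NP-double l (B n (e n)))) ⟩
    (q + p) * (M ^ k * (NP k (B n (e n)) + NP k (B n (e n))))
      ≡⟨ trans (sym (*-assoc (q + p) (M ^ k) _)) (sym (regroup (M ^ k) (q + p) _)) ⟩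
    2 * M ^ k * ((q + p) * NP k (B n (e n))) ∎)
    where
    open ≤-Reasoning
    2Mᵏ≢0 : NonZero (2 * M ^ k)
    2Mᵏ≢0 = m*n≢0 2 (M ^ k) ⦃ _ ⦄ ⦃ m^n≢0 M k ⦃ >-nonZero (<⇒≤ 2≤M) ⦄ ⦄
    regroup : ∀ m q x → 2 * m * (q * x) ≡ q * m * (x + x)
    regroup = solve-∀
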